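{- For every unsatisfiable CNF formula $F$, every tree-like resolution refutation of $F\circ\mathrm{OR}$ has size $\exp(\Omega(\mathrm{DT}_1(\mathrm{Search}(F))))$; that is, there is an absolute constant $\varepsilon>0$ such that for every unsatisfiable CNF $F$ every tree-like resolution refutation of $F\circ \mathrm{OR}$ has size at least $2^{\varepsilon\,\mathrm{DT}_1(\mathrm{Search}(F))}$.
   Context: $F\circ\mathrm{OR}$: replace each variable $x$ of $F$ by two new variables $x_1,x_2$; for each clause $C\in F$ include the clauses of the CNF expansion of the expression obtained from $C$ by replacing each positive literal $x$ by $x_1\vee x_2$ and each negative literal $\overline{x}$ by $\overline{x_1}\wedge\overline{x_2}$ (distributing, so $C$ gives one clause for each choice of one of $\overline{x_1},\overline{x_2}$ for every negative literal $\overline{x}$ of $C$). $\mathrm{Search}(F)$ is the relation whose inputs are the assignments $\alpha$ to the variables of $F$ and whose valid outputs on $\alpha$ are the clauses of $F$ falsified by $\alpha$. For a relation $f$, $\mathrm{DT}_1(f)$ is the minimum, over all decision trees computing $f$ (querying one variable at a time and outputting at each leaf a valid output for all inputs reaching it), of the maximum over root-to-leaf paths of the number of queries on the path answered $1$. Tree-like resolution: refutations using the rule "from $C\vee x$ and $D\vee\overline{x}$ infer $C\vee D$" (and optionally weakening) deriving the empty clause, where the underlying derivation graph is a tree; the size is the number of clauses (nodes) in the tree. -}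

module Defs where

open import Data.Bool using (Bool; true; false; not; if_then_else_)
open import Data.Nat using (ℕ; zero; suc; _+_; _≤_; _⊔_)
open import Data.Fin using (Fin)
open import Data.Fin.Subset as Subset using (Subset; inside; outside; ⁅_⁆; ∁; _∩_)
open import Data.Vec as Vec using (_++_)
open import Data.List as List using (List; map; concatMap)
open import Data.List.Membership.Propositional using (_∈_)
open import Data.List.Relation.Unary.All using (All)
open import Data.Product using (∃-syntax; _×_)
open import Relation.Binary.PropositionalEquality using (_≡_)
open import Relation.Nullary using (¬_)

-- Propositional variables are the elements of Fin n.

Assignment : ℕ → Set
Assignment n = Fin n → Bool

data Literal (n : ℕ) : Set where
  pos neg : Fin n → Literal n

⟦_⟧ : ∀ {n} → Literal n → Assignment n → Bool
⟦ pos x ⟧ α = α x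
⟦ neg x ⟧ α = not (α x)

-- A clause is a finite set of literals, stored as the set of variables that
-- occur positively and the set of those that occur negatively; _≡_ is
-- therefore equality of sets of literals.  Tautological clauses are allowed.
record Clause (n : ℕ) : Set where
  constructor clause
  field
    positives : Subset n
    negatives : Subset n

open Clause public

CNF : ℕ → Set
CNF n = List (Clause n)

infix 4 _∈ˡ_ _⊆ᶜ_
infixr 6 _∨_

_∈ˡ_ : ∀ {n} → Literal n → Clause n → Set
pos x ∈ˡ C = x Subset.∈ positives C
neg x ∈ˡ C = x Subset.∈ negatives C

_⊆ᶜ_ : ∀ {n} → Clause n → Clause n → Set
C ⊆ᶜ D = ∀ l → l ∈ˡ C → l ∈ˡ D

□ : ∀ {n} → Clause n
□ = clause Subset.⊥ Subset.⊥

unit : ∀ {n} → Literal n → Clause n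
unit (pos x) = clause ⁅ x ⁆ Subset.⊥
unit (neg x) = clause Subset.⊥ ⁅ x ⁆

_∨_ : ∀ {n} → Clause n → Clause n → Clause n
C ∨ D = clause (positives C Subset.∪ positives D)
               (negatives C Subset.∪ negatives D)

Satisfies : ∀ {n} → Assignment n → Clause n → Set
Satisfies α C = ∃[ l ] (l ∈ˡ C × ⟦ l ⟧ α ≡ true)

Falsifies : ∀ {n} → Assignment n → Clause n → Set
Falsifies α C = ∀ l → l ∈ˡ C → ⟦ l ⟧ α ≡ false

Unsatisfiable : ∀ {n} → CNF n → Set
Unsatisfiable F = ∀ α → ¬ All (Satisfies α) F

allSubsets : ∀ n → List (Subset n)
allSubsets zero    = Vec.[] List.∷ List.[]
allSubsets (suc n) = map (inside Vec.∷_) (allSubsets n)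
              List.++ map (outside Vec.∷_) (allSubsets n)

-- The two copies of a variable x : Fin n are x₁ = x ↑ˡ n and x₂ = n ↑ʳ x in
-- Fin (n + n), so P ++ Q is the set { x₁ | x ∈ P } ∪ { x₂ | x ∈ Q }.
-- The set σ records the choices made when distributing: a negative literal on
-- x becomes the negation of x₁ if x ∈ σ, and the negation of x₂ otherwise.
-- Only σ restricted to the negative variables of C matters.
orClause : ∀ {n} → Clause n → Subset n → Clause (n + n)
orClause C σ = clause (positives C ++ positives C)
                      ((negatives C ∩ σ) ++ (negatives C ∩ ∁ σ))

infix 8 _∘OR

_∘OR : ∀ {n} → CNF n → CNF (n + n)
_∘OR {n} F = concatMap (λ C → map (orClause C) (allSubsets n)) F

-- The inductive type makes derivations trees: a clause used several times has
-- to be derived several times.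
data Derivation {n} (F : CNF n) : Clause n → Set where
  axiom   : ∀ {C} → C ∈ F → Derivation F C
  resolve : ∀ x C D →
            Derivation F (C ∨ unit (pos x)) →
            Derivation F (D ∨ unit (neg x)) →
            Derivation F (C ∨ D)
  weaken  : ∀ {C D} → C ⊆ᶜ D → Derivation F C → Derivation F D

Refutation : ∀ {n} → CNF n → Set
Refutation F = Derivation F □

size : ∀ {n} {F : CNF n} {C} → Derivation F C → ℕ
size (axiom _)           = 1
size (resolve _ _ _ π ρ) = suc (size π + size ρ)
size (weaken _ π)        = suc (size π)

SearchProblem : ℕ → Set → Set₁
SearchProblem n O = Assignment n → O → Set

Search : ∀ {n} → CNF n → SearchProblem n (Clause n)
Search F α C = C ∈ F × Falsifies α C

-- In query x t₀ t₁ the subtree tᵢ is entered on answer i.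
data DecisionTree (n : ℕ) (O : Set) : Set where
  leaf  : O → DecisionTree n O
  query : Fin n → DecisionTree n O → DecisionTree n O → DecisionTree n O

run : ∀ {n O} → DecisionTree n O → Assignment n → O
run (leaf o)        α = o
run (query x t₀ t₁) α = if α x then run t₁ α else run t₀ α

Computes : ∀ {n O} → DecisionTree n O → SearchProblem n O → Set
Computes T f = ∀ α → f α (run T α)

-- Maximum over root-to-leaf paths of the number of queries answered 1.
ones : ∀ {n O} → DecisionTree n O → ℕ
ones (leaf _)        = 0
ones (query _ t₀ t₁) = ones t₀ ⊔ suc (ones t₁)

-- DT₁ f ≐ d says that DT₁(f) = d: the minimum of ones over the decision trees
-- computing f is attained and equals d.
infix 4 DT₁_≐_

DT₁_≐_ : ∀ {n O} → SearchProblem n O → ℕ → Set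
DT₁ f ≐ d = (∃[ T ] (Computes T f × ones T ≡ d))
          × (∀ T → Computes T f → d ≤ ones T)

{-# OPTIONS --safe #-}

-- A refutation π of F ∘OR is walked down from the root, always to a premise
-- falsified by the current partial assignment to the copies, and this yields a
-- decision tree for Search F.  At a resolution step on a copy of an unqueried
-- x whose copies are both unset, compare the two subderivations.  If the one for
-- "copy = 1" is the smaller, query x: an answer 1 halves the size, an answer 0
-- sets both copies to 0.  Otherwise set the copy to 0 without querying x, which
-- also halves the size; that halving pays for an answer 1 when x is queried
-- later, on reaching the other copy.  Hence 2 ^ ones ≤ size, so that ε = 1.
module Submission where

open import Defs
open import Data.Nat using (ℕ; suc; _+_; _*_; _^_; _≤_; _<_; _⊔_; z≤n; s≤s)
open import Data.Nat.Properties
open import Data.Nat.Solver using (module +-*-Solver)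
open import Data.Bool as Bool using (Bool; true; false)
open import Data.Bool.Properties using (∨-zeroʳ)
open import Data.Empty using (⊥-elim)
open import Data.Fin using (Fin; zero; suc; _↑ˡ_; _↑ʳ_; splitAt)
open import Data.Fin.Properties using (splitAt-↑ˡ; splitAt-↑ʳ) renaming (_≟_ to _≟ᶠ_)
open import Data.Fin.Subset as Subset using (Subset)
open import Data.Fin.Subset.Properties using (∉⊥; x∈⁅y⁆⇒x≡y; x∈p∪q⁻; x∈p∪q⁺; x∈p∩q⁺; x∉p⇒x∈∁p; _∈?_)
open import Data.List.Membership.Propositional using (_∈_; find)
open import Data.List.Membership.Propositional.Properties using (∈-map⁻; ∈-concatMap⁻)
open import Data.Maybe using (Maybe; just; nothing)
open import Data.Maybe.Properties using (just-injective)
open import Data.Product using (∃-syntax; _×_; _,_; proj₁; proj₂)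
open import Data.Sum using (_⊎_; inj₁; inj₂; [_,_]′)
open import Data.Unit using (⊤; tt)
open import Data.Vec using (Vec; []; _∷_; lookup; replicate; _[_]≔_; _++_)
open import Data.Vec.Properties
  using (lookup⇒[]=; []=⇒lookup; lookup-++ˡ; lookup-++ʳ; lookup∘update; lookup∘update′; lookup-replicate)
open import Function using (_∘_)
open import Relation.Binary.PropositionalEquality
  using (_≡_; refl; sym; trans; cong; cong₂; subst; module ≡-Reasoning)
open import Relation.Nullary using (yes; no)

-- Copies of a variable and the states of a pair

data Copy : Set where
  first second : Copy

origin : ∀ {n} → Fin (n + n) → Copy × Fin n
origin {n} y = [ (first ,_) , (second ,_) ]′ (splitAt n y)

copy : ∀ {n} → Copy → Fin n → Fin (n + n)
copy {n} first  x = x ↑ˡ n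
copy {n} second x = n ↑ʳ x

origin-copy : ∀ {n} c (x : Fin n) → origin (copy c x) ≡ (c , x)
origin-copy {n} first  x = cong [ (first ,_) , (second ,_) ]′ (splitAt-↑ˡ n x n)
origin-copy {n} second x = cong [ (first ,_) , (second ,_) ]′ (splitAt-↑ʳ n n x)

-- The variables in state known are exactly those queried; in state half c only
-- copy c is set, to 0.
data State : Set where
  free  : State
  half  : Copy → State
  known : (Copy → Bool) → State

neither : Copy → Bool
neither _ = false

only : Copy → Copy → Bool
only first  first  = true
only first  second = false
only second first  = false
only second second = true

disjunction : (Copy → Bool) → Bool
disjunction f = f first Bool.∨ f second

only-self : ∀ c → only c c ≡ true
only-self first  = refl
only-self second = refl

disjunction-true : ∀ f c → f c ≡ true → disjunction f ≡ true
disjunction-true f first  eq rewrite eq = refl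
disjunction-true f second eq rewrite eq = ∨-zeroʳ (f first)

value : State → Copy → Maybe Bool
value free          _      = nothing
value (half first)  first  = just false
value (half first)  second = nothing
value (half second) first  = nothing
value (half second) second = just false
value (known f)     c      = just (f c)

value-half : ∀ c → value (half c) c ≡ just false
value-half first  = refl
value-half second = refl

_⊑_ : State → State → Set
s ⊑ t = ∀ c {b} → value s c ≡ just b → value t c ≡ just b

half⊑neither : ∀ c → half c ⊑ known neither
half⊑neither first  first  eq = eq
half⊑neither second second eq = eq

-- Having no value at `c`, the half-set pair has its 0 on the other copy, which is where `only c`
-- puts 0 as well. So a later answer 1 undoes nothing.
half⊑only : ∀ c c′ → value (half c′) c ≡ nothing → half c′ ⊑ known (only c)
half⊑only first  first  ()
half⊑only first  second _  second eq = eq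
half⊑only second first  _  first  eq = eq
half⊑only second second ()

-- An unqueried variable is left unrestricted: with at most one copy set, and that one to 0, the
-- other copy can still give the disjunction either value.
Agrees : Bool → State → Set
Agrees b (known f) = b ≡ disjunction f
Agrees b _         = ⊤

-- Both copies have a value only after a query, so the answer is the disjunction of two zeros.
value-false : ∀ {b} s → Agrees b s → (∀ c → value s c ≡ just false) → b ≡ false
value-false free          _ v with () ← v first
value-false (half first)  _ v with () ← v second
value-false (half second) _ v with () ← v first
value-false (known f)     a v =
  trans a (cong₂ Bool._∨_ (just-injective (v first)) (just-injective (v second)))

-- Half-set pairs hold only a 0, so a copy equal to 1 comes from a query, and it forces the
-- disjunction to 1.
value-true : ∀ {b} s c → Agrees b s → value s c ≡ just true → b ≡ true
value-true (half first)  first  _ ()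
value-true (half second) second _ ()
value-true (known f)     c      a v = trans a (disjunction-true f c (just-injective v))

-- Weights and the potential

weight : State → ℕ
weight (half _) = 2
weight _        = 1

States : ℕ → Set
States = Vec State

-- This is 2 to the number of half-set variables: one factor 2 of credit for each halving of the
-- size not yet spent on an answer 1.
potential : ∀ {n} → States n → ℕ
potential []      = 1
potential (s ∷ ρ) = weight s * potential ρ

potential-free : ∀ n → potential (replicate n free) ≡ 1
potential-free ℕ.zero  = refl
potential-free (suc n) = trans (*-identityˡ _) (potential-free n)

-- One factor of the product is exchanged; cross-multiplying avoids division by the old weight.
potential-update : ∀ {n} (ρ : States n) x s →
  potential (ρ [ x ]≔ s) * weight (lookup ρ x) ≡ potential ρ * weight s
potential-update (t ∷ ρ) zero    s =
  solve 3 (λ a b c → (a :* b) :* c := (c :* b) :* a) refl (weight s) (potential ρ) (weight t)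
  where open +-*-Solver
potential-update (t ∷ ρ) (suc x) s = begin
  weight t * potential (ρ [ x ]≔ s) * weight (lookup ρ x)   ≡⟨ *-assoc (weight t) _ _ ⟩
  weight t * (potential (ρ [ x ]≔ s) * weight (lookup ρ x)) ≡⟨ cong (weight t *_) (potential-update ρ x s) ⟩
  weight t * (potential ρ * weight s)                       ≡⟨ *-assoc (weight t) _ _ ⟨
  weight t * potential ρ * weight s                         ∎
  where open ≡-Reasoning

lookup-update-elim : ∀ {n} (P : Fin n → State → Set) (ρ : States n) x {s} →
  P x s → (∀ z → P z (lookup ρ z)) → ∀ z → P z (lookup (ρ [ x ]≔ s) z)
lookup-update-elim P ρ x {s} p q z with z ≟ᶠ x
... | yes refl = subst (P z) (sym (lookup∘update z ρ s)) p
... | no  z≢x  = subst (P z) (sym (lookup∘update′ z≢x ρ s)) (q z)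

-- Partial assignments to the copies and the clauses they falsify

valueAt : ∀ {n} → States n → Copy × Fin n → Maybe Bool
valueAt ρ (c , x) = value (lookup ρ x) c

_≼_ : ∀ {n} → States n → States n → Set
ρ ≼ ρ′ = ∀ z → lookup ρ z ⊑ lookup ρ′ z

≼-refl : ∀ {n} (ρ : States n) → ρ ≼ ρ
≼-refl ρ z c eq = eq

≼-update : ∀ {n} (ρ : States n) x {s} → lookup ρ x ⊑ s → ρ ≼ (ρ [ x ]≔ s)
≼-update ρ x le = lookup-update-elim (λ z t → lookup ρ z ⊑ t) ρ x le (≼-refl ρ)

valueAt-update : ∀ {n} (ρ : States n) x s c → valueAt (ρ [ x ]≔ s) (c , x) ≡ value s c
valueAt-update ρ x s c = cong (λ t → value t c) (lookup∘update x ρ s)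

Refutes : ∀ {n} → States n → Literal (n + n) → Set
Refutes ρ (pos y) = valueAt ρ (origin y) ≡ just false
Refutes ρ (neg y) = valueAt ρ (origin y) ≡ just true

RefutesAll : ∀ {n} → States n → Clause (n + n) → Set
RefutesAll ρ C = ∀ l → l ∈ˡ C → Refutes ρ l

refutes-≼ : ∀ {n} (ρ ρ′ : States n) → ρ ≼ ρ′ → ∀ l → Refutes ρ l → Refutes ρ′ l
refutes-≼ _ _ le (pos y) = le _ _
refutes-≼ _ _ le (neg y) = le _ _

∈-unit : ∀ {n} (l k : Literal n) → l ∈ˡ unit k → l ≡ k
∈-unit (pos x) (pos y) i = cong pos (x∈⁅y⁆⇒x≡y y i)
∈-unit (pos x) (neg y) i = ⊥-elim (∉⊥ i)
∈-unit (neg x) (pos y) i = ⊥-elim (∉⊥ i)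
∈-unit (neg x) (neg y) i = cong neg (x∈⁅y⁆⇒x≡y y i)

∈-∨⁻ : ∀ {n} (C D : Clause n) l → l ∈ˡ C ∨ D → l ∈ˡ C ⊎ l ∈ˡ D
∈-∨⁻ C D (pos x) = x∈p∪q⁻ (positives C) (positives D)
∈-∨⁻ C D (neg x) = x∈p∪q⁻ (negatives C) (negatives D)

∨-upperˡ : ∀ {n} (C D : Clause n) → C ⊆ᶜ C ∨ D
∨-upperˡ C D (pos x) = x∈p∪q⁺ ∘ inj₁
∨-upperˡ C D (neg x) = x∈p∪q⁺ ∘ inj₁

∨-upperʳ : ∀ {n} (C D : Clause n) → D ⊆ᶜ C ∨ D
∨-upperʳ C D (pos x) = x∈p∪q⁺ ∘ inj₂
∨-upperʳ C D (neg x) = x∈p∪q⁺ ∘ inj₂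

refutesAll-∨unit : ∀ {n} {ρ ρ′ : States n} C k →
  ρ ≼ ρ′ → RefutesAll ρ C → Refutes ρ′ k → RefutesAll ρ′ (C ∨ unit k)
refutesAll-∨unit {ρ = ρ} {ρ′} C k le r rk l i with ∈-∨⁻ C (unit k) l i
... | inj₁ l∈C = refutes-≼ ρ ρ′ le l (r l l∈C)
... | inj₂ l∈k = subst (Refutes ρ′) (sym (∈-unit l k l∈k)) rk

-- Falsified clauses of `F ∘OR`

∈-++⁺ˡ : ∀ {n} {p q : Subset n} {x} → x Subset.∈ p → copy first x Subset.∈ (p ++ q)
∈-++⁺ˡ {p = p} {q} {x} i = lookup⇒[]= _ (p ++ q) (trans (lookup-++ˡ p q x) ([]=⇒lookup i))

∈-++⁺ʳ : ∀ {n} {p q : Subset n} {x} → x Subset.∈ q → copy second x Subset.∈ (p ++ q)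
∈-++⁺ʳ {p = p} {q} {x} i = lookup⇒[]= _ (p ++ q) (trans (lookup-++ʳ p q x) ([]=⇒lookup i))

∈-∘OR⁻ : ∀ {n} (F : CNF n) {K} → K ∈ F ∘OR → ∃[ C ] (C ∈ F × ∃[ σ ] K ≡ orClause C σ)
∈-∘OR⁻ {n} F K∈ with find (∈-concatMap⁻ _ {xs = F} K∈)
... | C , C∈F , K∈C with ∈-map⁻ (orClause C) {xs = allSubsets n} K∈C
...   | σ , _ , eq = C , C∈F , σ , eq

Consistent : ∀ {n} → Assignment n → States n → Set
Consistent α ρ = ∀ z → Agrees (α z) (lookup ρ z)

-- A positive literal contributes both copies, so both are 0. A negative literal contributes one
-- negated copy, and its being 1 already makes the disjunction 1.
refutesAll-orClause : ∀ {n} {ρ : States n} {α} C σ →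
  RefutesAll ρ (orClause C σ) → Consistent α ρ → Falsifies α C
refutesAll-orClause {ρ = ρ} C σ r a (pos x) x∈ = value-false (lookup ρ x) (a x) values
  where
  values : ∀ c → value (lookup ρ x) c ≡ just false
  values first  = subst (λ o → valueAt ρ o ≡ just false) (origin-copy first x)  (r (pos (copy first x)) (∈-++⁺ˡ x∈))
  values second = subst (λ o → valueAt ρ o ≡ just false) (origin-copy second x) (r (pos (copy second x)) (∈-++⁺ʳ x∈))
refutesAll-orClause {ρ = ρ} {α} C σ r a (neg x) x∈ = cong Bool.not αx≡true
  where
  αx : ∀ c → neg (copy c x) ∈ˡ orClause C σ → α x ≡ true
  αx c i = value-true (lookup ρ x) c (a x)
             (subst (λ o → valueAt ρ o ≡ just true) (origin-copy c x) (r (neg (copy c x)) i))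
  αx≡true : α x ≡ true
  -- The choice `σ` decides which negated copy occurs in the clause.
  αx≡true with x ∈? σ
  ... | yes x∈σ = αx first  (∈-++⁺ˡ (x∈p∩q⁺ (x∈ , x∈σ)))
  ... | no  x∉σ = αx second (∈-++⁺ʳ (x∈p∩q⁺ (x∈ , x∉p⇒x∈∁p x∉σ)))

-- Decision trees paid for by size and potential

record Solvable {n} (F : CNF n) (ρ : States n) (m : ℕ) : Set where
  constructor solution
  field
    tree    : DecisionTree n (Clause n)
    correct : ∀ α → Consistent α ρ → Search F α (run tree α)
    cost    : 2 ^ ones tree ≤ m * potential ρ

solvable-mono : ∀ {n} {F : CNF n} {ρ m m′} → m ≤ m′ → Solvable F ρ m → Solvable F ρ m′
solvable-mono {ρ = ρ} le (solution T ok bound) =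
  solution T ok (≤-trans bound (*-monoˡ-≤ (potential ρ) le))

2^-⊔-lub : ∀ {k l m} → 2 ^ k ≤ m → 2 ^ l ≤ m → 2 ^ (k ⊔ l) ≤ m
2^-⊔-lub {k} {l} p q with ⊔-sel k l
... | inj₁ eq rewrite eq = p
... | inj₂ eq rewrite eq = q

consistent-known : ∀ {n} {α : Assignment n} {ρ x b f} →
  Consistent α ρ → α x ≡ b → b ≡ disjunction f → Consistent α (ρ [ x ]≔ known f)
consistent-known {α = α} {ρ} {x} a αx eq =
  lookup-update-elim (λ z → Agrees (α z)) ρ x (trans αx eq) a

potential-known : ∀ {n} (ρ : States n) x {f} →
  potential (ρ [ x ]≔ known f) * weight (lookup ρ x) ≡ potential ρ
potential-known ρ x {f} = trans (potential-update ρ x (known f)) (*-identityʳ _)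

1≤weight : ∀ s → 1 ≤ weight s
1≤weight free      = s≤s z≤n
1≤weight (half _)  = s≤s z≤n
1≤weight (known _) = s≤s z≤n

-- Answer 0 is not counted, and querying never raises the potential. Answer 1 costs a factor 2,
-- covered by a drop from `m` to `m₁`, by the old weight of `x` (2 if half-set, 1 after the query),
-- or by both.
solvable-query : ∀ {n} {F : CNF n} ρ x c {m₀ m₁ m} →
  m₀ ≤ m → 2 * m₁ ≤ m * weight (lookup ρ x) →
  Solvable F (ρ [ x ]≔ known neither) m₀ → Solvable F (ρ [ x ]≔ known (only c)) m₁ →
  Solvable F ρ m
solvable-query {F = F} ρ x c {m₀} {m₁} {m} le₀ le₁ (solution T₀ ok₀ bound₀) (solution T₁ ok₁ bound₁) =
  solution (query x T₀ T₁) ok (2^-⊔-lub {ones T₀} bound₀′ bound₁′)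
  where
  open ≤-Reasoning
  w = weight (lookup ρ x)
  p₀ = potential (ρ [ x ]≔ known neither)
  p₁ = potential (ρ [ x ]≔ known (only c))

  ok : ∀ α → Consistent α ρ → Search F α (run (query x T₀ T₁) α)
  ok α a with α x in αx
  ... | true  = ok₁ α (consistent-known {ρ = ρ} a αx (sym (disjunction-true (only c) c (only-self c))))
  ... | false = ok₀ α (consistent-known {ρ = ρ} a αx refl)

  bound₀′ : 2 ^ ones T₀ ≤ m * potential ρ
  bound₀′ = begin
    2 ^ ones T₀     ≤⟨ bound₀ ⟩
    -- A factor 1 is inserted and then raised to `w`, so that `p₀ * w` becomes the old potential.
    m₀ * p₀         ≤⟨ *-mono-≤ le₀ (≤-reflexive (sym (*-identityʳ p₀))) ⟩
    m * (p₀ * 1)    ≤⟨ *-monoʳ-≤ m (*-monoʳ-≤ p₀ (1≤weight (lookup ρ x))) ⟩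
    m * (p₀ * w)    ≡⟨ cong (m *_) (potential-known ρ x) ⟩
    m * potential ρ ∎

  bound₁′ : 2 ^ suc (ones T₁) ≤ m * potential ρ
  bound₁′ = begin
    2 * 2 ^ ones T₁ ≤⟨ *-monoʳ-≤ 2 bound₁ ⟩
    2 * (m₁ * p₁)   ≡⟨ *-assoc 2 m₁ p₁ ⟨
    2 * m₁ * p₁     ≤⟨ *-monoˡ-≤ p₁ le₁ ⟩
    m * w * p₁      ≡⟨ *-assoc m w p₁ ⟩
    m * (w * p₁)    ≡⟨ cong (m *_) (*-comm w p₁) ⟩
    m * (p₁ * w)    ≡⟨ cong (m *_) (potential-known ρ x) ⟩
    m * potential ρ ∎

-- The same tree serves, because a half-set pair restricts no `α`. The weight of `x` rises from 1 to
-- 2, and the halved size absorbs the doubled potential.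
solvable-half : ∀ {n} {F : CNF n} ρ x c {m₀ m} → lookup ρ x ≡ free → 2 * m₀ ≤ m →
  Solvable F (ρ [ x ]≔ half c) m₀ → Solvable F ρ m
solvable-half {F = F} ρ x c {m₀} {m} x-free le (solution T ok bound) = solution T ok′ bound′
  where
  open ≤-Reasoning
  p = potential (ρ [ x ]≔ half c)

  ok′ : ∀ α → Consistent α ρ → Search F α (run T α)
  ok′ α a = ok α (lookup-update-elim (λ z → Agrees (α z)) ρ x tt a)

  p≡ : p ≡ potential ρ * 2
  p≡ = begin-equality
    p                       ≡⟨ *-identityʳ p ⟨
    p * 1                   ≡⟨ cong (λ s → p * weight s) x-free ⟨
    p * weight (lookup ρ x) ≡⟨ potential-update ρ x (half c) ⟩
    potential ρ * 2         ∎

  bound′ : 2 ^ ones T ≤ m * potential ρ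
  bound′ = begin
    2 ^ ones T             ≤⟨ bound ⟩
    m₀ * p                 ≡⟨ cong (m₀ *_) (trans p≡ (*-comm (potential ρ) 2)) ⟩
    m₀ * (2 * potential ρ) ≡⟨ *-assoc m₀ 2 (potential ρ) ⟨
    m₀ * 2 * potential ρ   ≡⟨ cong (_* potential ρ) (*-comm m₀ 2) ⟩
    2 * m₀ * potential ρ   ≤⟨ *-monoˡ-≤ (potential ρ) le ⟩
    m * potential ρ        ∎

double≤sum : ∀ {a b} → a ≤ b → 2 * a ≤ a + b
double≤sum {a} le = +-monoʳ-≤ a (≤-trans (≤-reflexive (+-identityʳ a)) le)

-- A value for `y` makes one premise falsified: value 0 the one of size `a`, value 1 the one of size
-- `b`. The hypotheses range over all `ρ′` because the premise may be entered after an update of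
-- `ρ`.
solvable-resolve : ∀ {n} {F : CNF n} y {C D a b} (ρ : States n) →
  (∀ ρ′ → RefutesAll ρ′ (C ∨ unit (pos y)) → Solvable F ρ′ a) →
  (∀ ρ′ → RefutesAll ρ′ (D ∨ unit (neg y)) → Solvable F ρ′ b) →
  RefutesAll ρ (C ∨ D) → Solvable F ρ (suc (a + b))
solvable-resolve {n} {F} y {C} {D} {a} {b} ρ ihC ihD r = go (lookup ρ x) refl
  where
  c = proj₁ (origin {n} y)
  x = proj₂ (origin {n} y)

  a≤ : a ≤ suc (a + b)
  a≤ = m≤n⇒m≤1+n (m≤m+n a b)

  b≤ : b ≤ suc (a + b)
  b≤ = m≤n⇒m≤1+n (m≤n+m b a)

  toC : ∀ ρ′ → ρ ≼ ρ′ → valueAt ρ′ (c , x) ≡ just false → Solvable F ρ′ a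
  toC ρ′ le v =
    ihC ρ′ (refutesAll-∨unit {ρ = ρ} {ρ′} C (pos y) le (λ l → r l ∘ ∨-upperˡ C D l) v)

  toD : ∀ ρ′ → ρ ≼ ρ′ → valueAt ρ′ (c , x) ≡ just true → Solvable F ρ′ b
  toD ρ′ le v =
    ihD ρ′ (refutesAll-∨unit {ρ = ρ} {ρ′} D (neg y) le (λ l → r l ∘ ∨-upperʳ C D l) v)

  toC-update : ∀ s → lookup ρ x ⊑ s → value s c ≡ just false → Solvable F (ρ [ x ]≔ s) a
  toC-update s le v = toC (ρ [ x ]≔ s) (≼-update ρ x {s} le) (trans (valueAt-update ρ x s c) v)

  toD-update : ∀ s → lookup ρ x ⊑ s → value s c ≡ just true → Solvable F (ρ [ x ]≔ s) b
  toD-update s le v = toD (ρ [ x ]≔ s) (≼-update ρ x {s} le) (trans (valueAt-update ρ x s c) v)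

  query-x : lookup ρ x ⊑ known neither → lookup ρ x ⊑ known (only c) →
            2 * b ≤ suc (a + b) * weight (lookup ρ x) → Solvable F ρ (suc (a + b))
  query-x le₀ le₁ halved = solvable-query ρ x c a≤ halved
    (toC-update (known neither) le₀ refl) (toD-update (known (only c)) le₁ (cong just (only-self c)))

  assigned : ∀ v → valueAt ρ (c , x) ≡ just v → Solvable F ρ (suc (a + b))
  assigned false eq = solvable-mono a≤ (toC ρ (≼-refl ρ) eq)
  assigned true  eq = solvable-mono b≤ (toD ρ (≼-refl ρ) eq)

  go : ∀ s → lookup ρ x ≡ s → Solvable F ρ (suc (a + b))
  go free eq with ≤-total b a
  -- The weight is 1 here, so answer 1 must be paid by the smaller premise alone: `b ≤ a` gives
  -- `2 * b ≤ a + b`.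
  ... | inj₁ b≤a = query-x (free⊑ (known neither)) (free⊑ (known (only c))) (begin
    2 * b                                ≤⟨ double≤sum b≤a ⟩
    b + a                                ≡⟨ +-comm b a ⟩
    a + b                                ≤⟨ n≤1+n (a + b) ⟩
    suc (a + b)                          ≡⟨ *-identityʳ _ ⟨
    suc (a + b) * 1                      ≡⟨ cong (λ s → suc (a + b) * weight s) eq ⟨
    suc (a + b) * weight (lookup ρ x)    ∎)
    where
    open ≤-Reasoning
    free⊑ : ∀ t → lookup ρ x ⊑ t
    free⊑ t rewrite eq = λ _ ()
  ... | inj₂ a≤b = solvable-half ρ x c eq (m≤n⇒m≤1+n (double≤sum a≤b))
    (toC-update (half c) (subst (_⊑ half c) (sym eq) (λ _ ())) (value-half c))
  go (half c′) eq with value (half c′) c in v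
  ... | just b′ = assigned b′ (trans (cong (λ s → value s c) eq) v)
  -- The other copy was set to 0 earlier. The stored weight 2 pays for answer 1, so `a` and `b` need
  -- no comparison.
  ... | nothing = query-x
    (subst (_⊑ known neither) (sym eq) (half⊑neither c′))
    (subst (_⊑ known (only c)) (sym eq) (half⊑only c c′ v))
    (begin
      2 * b                             ≤⟨ *-monoʳ-≤ 2 b≤ ⟩
      2 * suc (a + b)                   ≡⟨ *-comm 2 (suc (a + b)) ⟩
      suc (a + b) * 2                   ≡⟨ cong (λ s → suc (a + b) * weight s) eq ⟨
      suc (a + b) * weight (lookup ρ x) ∎)
    where open ≤-Reasoning
  go (known f) eq = assigned (f c) (cong (λ s → value s c) eq)

-- From refutations to decision trees

1≤potential : ∀ {n} (ρ : States n) → 1 ≤ potential ρ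
1≤potential []      = ≤-refl
1≤potential (s ∷ ρ) = *-mono-≤ (1≤weight s) (1≤potential ρ)

derivation⇒solvable : ∀ {n} {F : CNF n} {K} (π : Derivation (F ∘OR) K) (ρ : States n) →
  RefutesAll ρ K → Solvable F ρ (size π)
derivation⇒solvable {F = F} (axiom K∈) ρ r with ∈-∘OR⁻ F K∈
-- A leaf has `2 ^ 0 = 1`, within the axiom's size 1 times a potential of at least 1.
... | C , C∈F , σ , refl = solution (leaf C) ok (*-mono-≤ {1} {1} ≤-refl (1≤potential ρ))
  where
  ok : ∀ α → Consistent α ρ → Search F α C
  ok α a = C∈F , refutesAll-orClause {ρ = ρ} C σ r a
derivation⇒solvable (resolve y C D π₀ π₁) ρ =
  solvable-resolve y ρ (derivation⇒solvable π₀) (derivation⇒solvable π₁)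
derivation⇒solvable (weaken C⊆D π) ρ r =
  solvable-mono (n≤1+n _) (derivation⇒solvable π ρ (λ l → r l ∘ C⊆D l))

□-empty : ∀ {n} (l : Literal n) {A : Set} → l ∈ˡ □ → A
□-empty (pos x) i = ⊥-elim (∉⊥ i)
□-empty (neg x) i = ⊥-elim (∉⊥ i)

refutation⇒decisionTree : ∀ {n} {F : CNF n} (π : Refutation (F ∘OR)) →
  ∃[ T ] (Computes T (Search F) × 2 ^ ones T ≤ size π)
refutation⇒decisionTree {n} π
  -- With all variables free, every `α` is consistent and the potential is 1, so no credit remains
  -- in the bound.
  with solution T ok bound ← derivation⇒solvable π (replicate n free) (λ l → □-empty l) =
  T , (λ α → ok α (λ z → subst (Agrees (α z)) (sym (lookup-replicate z free)) tt))
    , ≤-trans bound (≤-reflexive (trans (cong (size π *_) (potential-free n)) (*-identityʳ _)))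

lemma3p7 : ∃[ p ] ∃[ q ] (0 < p × 0 < q ×
    (∀ {n : ℕ} (F : CNF n) → Unsatisfiable F →
    ∀ (d : ℕ) → DT₁ Search F ≐ d →
    ∀ (π : Refutation (F ∘OR)) → 2 ^ (p * d) ≤ size π ^ q))
-- The constant ε is represented as the fraction `p / q`, here 1.
lemma3p7 = 1 , 1 , s≤s z≤n , s≤s z≤n , bound
  where
  open ≤-Reasoning
  bound : ∀ {n : ℕ} (F : CNF n) → Unsatisfiable F → ∀ d → DT₁ Search F ≐ d →
          (π : Refutation (F ∘OR)) → 2 ^ (1 * d) ≤ size π ^ 1
  bound F _ d (_ , minimal) π with T , computes , 2^ones≤ ← refutation⇒decisionTree π = begin
    2 ^ (1 * d) ≡⟨ cong (2 ^_) (*-identityˡ d) ⟩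
    2 ^ d       ≤⟨ ^-monoʳ-≤ 2 (minimal T computes) ⟩
    2 ^ ones T  ≤⟨ 2^ones≤ ⟩
    size π      ≡⟨ ^-identityʳ (size π) ⟨
    size π ^ 1  ∎
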